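{- The minimum number of monochromatic triangles in a line $2$-coloring of the Möbius-Kantor configuration, taken over all line $2$-colorings, is $0$.
   Context: A configuration is a pair $(\mathcal{P},\mathcal{L})$ with $\mathcal{P}$ a finite set of points and $\mathcal{L}$ a finite set of subsets of $\mathcal{P}$ called lines, such that any two distinct points lie together on at most one line, all points are on the same number of lines, all lines contain the same number of points, and there are at least three points. Three points $p_1,p_2,p_3$ form a triangle if there are lines $l_1,l_2,l_3$ with $p_1,p_2\in l_1$, $p_3\notin l_1$; $p_2,p_3\in l_2$, $p_1\notin l_2$; $p_1,p_3\in l_3$, $p_2\notin l_3$. The lines $l_1,l_2,l_3$ are then uniquely determined by the points. A line $2$-coloring assigns to each line one of the colors red, blue. A triangle is monochromatic if its lines $l_1,l_2,l_3$ all have the same color. The Möbius-Kantor configuration is the (unique) symmetric $8_3$ configuration: points $\mathbb{Z}/8$, lines $\{i,i+1,i+3\}$ for $i\in\mathbb{Z}/8$. -}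

module Defs where

import Data.Bool.Properties as Bool
open import Data.Fin.Base using (Fin; toℕ; _<_)
open import Data.Fin.Properties using (_≟_; _<?_; any?; all?)
open import Data.Fin.Subset using (Subset; _∈_; _∉_; ∣_∣; ⁅_⁆; _∪_)
open import Data.Fin.Subset.Properties using (_∈?_)
open import Data.List.Base using (List; allFin; cartesianProduct; filter; length)
open import Data.Nat.Base as ℕ using (ℕ; _≤_)
open import Data.Nat.DivMod using (_mod_)
import Data.Nat.Properties as ℕ
open import Data.Product.Base using (_×_; _,_; ∃)
open import Data.Vec.Base using (lookup; tabulate)
import Data.Vec.Properties as Vec
open import Function.Base using (_∘_)
open import Function.Definitions using (Injective)
open import Relation.Binary.Definitions using (DecidableEquality)
open import Relation.Binary.PropositionalEquality using (_≡_; _≢_; refl)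
open import Relation.Nullary.Decidable
  using (Dec; yes; no; from-yes; ¬?; _×-dec_; _→-dec_)

linesThrough : ∀ {v b} → (Fin b → Subset v) → Fin v → Subset b
linesThrough line p = tabulate (λ l → lookup (line l) p)

-- The points are Fin v; the finite set of lines is given by an injective
-- enumeration of b subsets of Fin v, so lines may be referred to by index.
record Configuration : Set where
  field
    v b            : ℕ
    line           : Fin b → Subset v
    line-injective : Injective _≡_ _≡_ line
    atMostOneLine  : ∀ p q → p ≢ q → ∀ l m →
                     p ∈ line l → q ∈ line l → p ∈ line m → q ∈ line m → l ≡ m
    r              : ℕ
    pointRegular   : ∀ p → ∣ linesThrough line p ∣ ≡ r
    k              : ℕ
    lineRegular    : ∀ l → ∣ line l ∣ ≡ k
    threePoints    : 3 ≤ v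

  Point Line : Set
  Point = Fin v
  Line  = Fin b

data Colour : Set where
  red blue : Colour

_≟ᶜ_ : DecidableEquality Colour
red  ≟ᶜ red  = yes refl
red  ≟ᶜ blue = no λ ()
blue ≟ᶜ red  = no λ ()
blue ≟ᶜ blue = yes refl

module _ (C : Configuration) where
  open Configuration C

  LineColouring : Set
  LineColouring = Line → Colour

  Side : Point → Point → Point → Line → Set
  Side p q s l = p ∈ line l × q ∈ line l × s ∉ line l

  -- The points p₁, p₂, p₃ form a triangle when such l₁, l₂, l₃ exist.
  IsTriangle : (p₁ p₂ p₃ : Point) (l₁ l₂ l₃ : Line) → Set
  IsTriangle p₁ p₂ p₃ l₁ l₂ l₃ =
    Side p₁ p₂ p₃ l₁ × Side p₂ p₃ p₁ l₂ × Side p₁ p₃ p₂ l₃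

  -- By atMostOneLine the lines of a triangle are determined by its points, so
  -- the existential quantification over lines involves no choice.
  IsMonochromaticTriangle : LineColouring → Point × Point × Point → Set
  IsMonochromaticTriangle c (p₁ , p₂ , p₃) =
    ∃ λ l₁ → ∃ λ l₂ → ∃ λ l₃ →
      IsTriangle p₁ p₂ p₃ l₁ l₂ l₃ × c l₁ ≡ c l₂ × c l₂ ≡ c l₃

  side? : ∀ p q s l → Dec (Side p q s l)
  side? p q s l = (p ∈? line l) ×-dec (q ∈? line l) ×-dec ¬? (s ∈? line l)

  isMonochromaticTriangle? : ∀ c t → Dec (IsMonochromaticTriangle c t)
  isMonochromaticTriangle? c (p₁ , p₂ , p₃) =
    any? λ l₁ → any? λ l₂ → any? λ l₃ →
      (side? p₁ p₂ p₃ l₁ ×-dec side? p₂ p₃ p₁ l₂ ×-dec side? p₁ p₃ p₂ l₃)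
        ×-dec (c l₁ ≟ᶜ c l₂) ×-dec (c l₂ ≟ᶜ c l₃)

  Increasing : Point × Point × Point → Set
  Increasing (p₁ , p₂ , p₃) = p₁ < p₂ × p₂ < p₃

  increasing? : ∀ t → Dec (Increasing t)
  increasing? (p₁ , p₂ , p₃) = (p₁ <? p₂) ×-dec (p₂ <? p₃)

  -- Being a triangle does not depend on the order of the three (necessarily
  -- distinct) points, so each one is counted once, as an increasing triple.
  pointTriples : List (Point × Point × Point)
  pointTriples = filter increasing?
    (cartesianProduct (allFin v) (cartesianProduct (allFin v) (allFin v)))

  monochromaticTriangles : LineColouring → List (Point × Point × Point)
  monochromaticTriangles c = filter (isMonochromaticTriangle? c) pointTriples

  numMonochromaticTriangles : LineColouring → ℕ
  numMonochromaticTriangles c = length (monochromaticTriangles c)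

IsMinimum : {A : Set} → (A → ℕ) → ℕ → Set
IsMinimum f m = (∃ λ a → f a ≡ m) × (∀ a → m ≤ f a)

mkLine : Fin 8 → Subset 8
mkLine i = ⁅ i ⁆ ∪ ⁅ (toℕ i ℕ.+ 1) mod 8 ⁆ ∪ ⁅ (toℕ i ℕ.+ 3) mod 8 ⁆

möbiusKantor : Configuration
möbiusKantor = record
  { v              = 8
  ; b              = 8
  ; line           = mkLine
  ; line-injective = λ {i} {j} → injective i j
  ; atMostOneLine  = from-yes (all? λ p → all? λ q → ¬? (p ≟ q) →-dec
      (all? λ l → all? λ m →
        (p ∈? mkLine l) →-dec (q ∈? mkLine l) →-dec
        (p ∈? mkLine m) →-dec (q ∈? mkLine m) →-dec (l ≟ m)))
  ; r              = 3
  ; pointRegular   = from-yes (all? λ p → ∣ linesThrough mkLine p ∣ ℕ.≟ 3)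
  ; k              = 3
  ; lineRegular    = from-yes (all? λ l → ∣ mkLine l ∣ ℕ.≟ 3)
  ; threePoints    = from-yes (3 ℕ.≤? 8)
  }
  where
  injective : ∀ i j → mkLine i ≡ mkLine j → i ≡ j
  injective = from-yes (all? λ i → all? λ j →
    Vec.≡-dec Bool._≟_ (mkLine i) (mkLine j) →-dec (i ≟ j))

{-# OPTIONS --safe #-}
module Submission where

open import Data.Fin.Base using (toℕ)
open import Data.Nat.Base using (z≤n; parity)
open import Data.Parity.Base using (Parity; 0ℙ; 1ℙ)
open import Data.Product.Base using (_,_)
open import Relation.Binary.PropositionalEquality using (refl)
open import Defs using (IsMinimum; numMonochromaticTriangles; möbiusKantor)
open import Defs using (Colour; red; blue; LineColouring)

parityColour : Parity → Colour
parityColour 0ℙ = red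
parityColour 1ℙ = blue

-- Lines {i, i+1, i+3} and {j, j+1, j+3} meet unless j = i + 4, and the four
-- lines of one parity are i, i+2, i+4, i+6: any three of them include a
-- disjoint pair, so no three form the sides of a triangle.
parityColouring : LineColouring möbiusKantor
parityColouring i = parityColour (parity (toℕ i))

theorem4p4 : IsMinimum (numMonochromaticTriangles möbiusKantor) 0
-- The disjointness argument is not formalised: `refl` holds by evaluation, as the decision
-- procedure searches all triples of lines for each of the 56 increasing triples of points and
-- rejects every one, so the filtered list is empty. Minimality is immediate because the count is a
-- natural number.
theorem4p4 = (parityColouring , refl) , λ _ → z≤n
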